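{- There is a computable procedure which, given any finite sequence $Cr_1,\ldots,Cr_K$ of closed critical formulas of $PA\epsilon$, terminates and produces a finite $\epsilon$-substitution $S$ that is correct and solving for $Cr_1,\ldots,Cr_K$; that is, for every $(c_{\exists x.\phi[x,\vec y]}(\vec t),v)\in S$ with $v\neq{?}$ one has $\overline{S}\vDash \phi[v,\vec t]\wedge\bigwedge_{u<v}\neg\phi[u,\vec t]$, and for every $I$ with $1\le I\le K$ one has $\overline{S}\vDash Cr_I$.
   Context: **Language.** $\mathcal{L}_0$ is the language of first-order arithmetic with a predicate symbol for each primitive recursively definable relation and with exactly the function symbols $0$ and $\mathbf{S}$. Given a language $\mathcal{L}$, its Skolemization $\mathcal{L}'$ is obtained by adding, for each formula $\exists x.\phi[x,y_1,\ldots,y_k]$ of $\mathcal{L}$ with $\phi$ quantifier-free, such that $\phi[x,0,\ldots,0]$ contains no closed Skolem terms and $y_1,\ldots,y_k$ include all free variables of $\phi$ besides $x$, a $k$-ary function symbol (Skolem function) $c_{\exists x.\phi[x,y_1,\ldots,y_k]}$ (here $k=0$ is allowed, and $\phi$ may contain Skolem functions whose arguments depend on $x$). Put $\mathcal{L}_{n+1}:=\mathcal{L}_n'$, $\mathcal{L}_\omega:=\bigcup_n\mathcal{L}_n$, and let $\mathcal{L}\epsilon$ be the quantifier-free part of $\mathcal{L}_\omega$. Within $\mathcal{L}\epsilon$, $\exists x.\phi[x,\vec t]$ abbreviates $\phi[c_{\exists x.\phi[x,\vec y]}(\vec t),\vec t]$ and $\forall x.\phi[x,\vec t]$ abbreviates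 $\phi[c_{\exists x.\neg\phi[x,\vec y]}(\vec t),\vec t]$. **Critical formulas.** The critical formulas of $PA\epsilon$ are the $\mathcal{L}\epsilon$-formulas of the following forms (with $\exists$ read as the abbreviation above): $\phi[t]\rightarrow\exists x.\phi[x]$; $\ \phi[0]\wedge\neg\phi[t]\rightarrow\exists x.(\phi[x]\wedge\neg\phi[\mathbf{S}x])$; $\ \neg s=0\rightarrow\exists x.\,s=\mathbf{S}x$. Here $\phi$ may contain further terms as parameters. Closed means without free variables. **$\epsilon$-substitutions.** A canonical term is a term $c(\vec t)$ with $c$ a Skolem function and each $t_i$ a numeral. An $\epsilon$-substitution is a function $S$ whose domain is a set of canonical terms and each of whose values is either a numeral or the symbol $?$. It is total if its domain is the set of all canonical terms. Its standard extension is $\overline{S}:=S\cup\{(e,?)\mid e \text{ canonical},\ e\notin\operatorname{dom}(S)\}$. **Evaluation.** For a closed term $t$, $\hat S(t)$ is defined as follows. $\hat S(0):=0$ and $\hat S(\mathbf{S}t):=\mathbf{S}\hat S(t)$. If $t=c(\vec s)$ is a non-canonical Skolem term and some $\hat S(s_i)$ is not a numeral, then $\hat S(t):=c(\hat S(\vec s))$; if every $\hat S(s_i)$ is a numeral, then $\hat S(t):=\hat S(c(\hat S(\vec s)))$, where $\hat S(s_1,\ldots,s_k):=\hat S(s_1),\ldots,\hat S(s_k)$. If $t$ is canonical, then $\hat S(t):=0$ if $S(t)={?}$, $\hat S(t):=S(t)$ if $S(t)$ is a numeral, and $\hat S(t):=t$ if $t\notin\operatorname{dom}(S)$. **Satisfaction.**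 For closed formulas of $\mathcal{L}\epsilon$: $S\vDash Rt_1\cdots t_n$ (respectively $S\vDash\neg Rt_1\cdots t_n$) iff every $\hat S(t_i)$ is a numeral and $R\hat S(t_1)\cdots\hat S(t_n)$ (respectively $\neg R\hat S(t_1)\cdots\hat S(t_n)$) holds in the standard model; $S\vDash\phi\wedge\psi$ iff $S\vDash\phi$ and $S\vDash\psi$; $S\vDash\neg(\phi\wedge\psi)$ iff $S\vDash\neg\phi$ or $S\vDash\neg\psi$; $S\vDash\phi\vee\psi$ iff $S\vDash\phi$ or $S\vDash\psi$; $S\vDash\neg(\phi\vee\psi)$ iff $S\vDash\neg\phi$ and $S\vDash\neg\psi$. Moreover $S\vDash\neg\neg\phi$ iff $S\vDash\phi$, and $\phi\rightarrow\psi$ is read as $\neg\phi\vee\psi$. -}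

module Defs where

open import Data.Empty using (⊥)
open import Data.Fin using (Fin; zero; suc)
open import Data.List using (List)
open import Data.List.Membership.Propositional using (_∈_)
open import Data.List.Relation.Unary.All using (All)
open import Data.Maybe using (Maybe; just; nothing; fromMaybe; map; zipWith)
open import Data.Nat using (ℕ; zero; suc; _+_; _∸_; _<_; pred)
open import Data.Nat.Properties
  using (≤-antisym; m∸n≡0⇒m≤n; n∸n≡0; m+n≡0⇒m≡0; m+n≡0⇒n≡0; pred[m∸n]≡m∸[1+n])
open import Data.Product using (Σ; ∃-syntax; _×_; proj₁)
open import Data.Sum using (_⊎_)
open import Data.Unit using (⊤)
open import Data.Vec using (Vec; []; _∷_; lookup; replicate; tabulate)
import Data.Vec as Vec
open import Function using (_∘_; _⇔_; mk⇔)
open import Relation.Binary.PropositionalEquality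
  using (_≡_; _≢_; refl; sym; trans; cong; cong₂)
open import Relation.Nullary using (¬_)

-- Codes of primitive recursive functions by arity; the recursion variable
-- of rec f g comes first, and g takes it, the previous value, the parameters.
data PR : ℕ → Set where
  zeroᵖ : PR 0
  sucᵖ  : PR 1
  proj  : ∀ {n} → Fin n → PR n
  comp  : ∀ {m n} → PR m → Vec (PR n) m → PR n
  rec   : ∀ {n} → PR n → PR (2 + n) → PR (suc n)

mutual
  ⟦_⟧ : ∀ {n} → PR n → Vec ℕ n → ℕ
  ⟦ zeroᵖ ⟧     _        = 0
  ⟦ sucᵖ ⟧      (m ∷ []) = suc m
  ⟦ proj i ⟧    ms       = lookup ms i
  ⟦ comp f gs ⟧ ms       = ⟦ f ⟧ (⟦ gs ⟧* ms)
  ⟦ rec f g ⟧   (m ∷ ms) = primRec f g m ms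

  ⟦_⟧* : ∀ {m n} → Vec (PR n) m → Vec ℕ n → Vec ℕ m
  ⟦ [] ⟧*     ms = []
  ⟦ g ∷ gs ⟧* ms = ⟦ g ⟧ ms ∷ ⟦ gs ⟧* ms

  primRec : ∀ {n} → PR n → PR (2 + n) → ℕ → Vec ℕ n → ℕ
  primRec f g zero    ms = ⟦ f ⟧ ms
  primRec f g (suc m) ms = ⟦ g ⟧ (m ∷ primRec f g m ms ∷ ms)

-- A k-ary primitive recursive relation is given by a primitive recursive
-- function whose zero set it is, so "truth" is the value 0.
Holds : ∀ {k} → PR k → Vec ℕ k → Set
Holds R ms = ⟦ R ⟧ ms ≡ 0

addᵖ : PR 2
addᵖ = rec (proj zero) (comp sucᵖ (proj (suc zero) ∷ []))

predᵖ : PR 1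
predᵖ = rec zeroᵖ (proj zero)

-- (m , n) ↦ n ∸ m
subᵖ : PR 2
subᵖ = rec (proj zero) (comp predᵖ (proj (suc zero) ∷ []))

-- (m , n) ↦ (n ∸ m) + (m ∸ n), which vanishes exactly when m = n
eqᵖ : PR 2
eqᵖ = comp addᵖ (subᵖ ∷ comp subᵖ (proj (suc zero) ∷ proj zero ∷ []) ∷ [])

addᵖ-correct : ∀ m n → ⟦ addᵖ ⟧ (m ∷ n ∷ []) ≡ m + n
addᵖ-correct zero    n = refl
addᵖ-correct (suc m) n = cong suc (addᵖ-correct m n)

predᵖ-correct : ∀ m → ⟦ predᵖ ⟧ (m ∷ []) ≡ pred m
predᵖ-correct zero    = refl
predᵖ-correct (suc m) = refl

subᵖ-correct : ∀ m n → ⟦ subᵖ ⟧ (m ∷ n ∷ []) ≡ n ∸ m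
subᵖ-correct zero    n = refl
subᵖ-correct (suc m) n =
  trans (predᵖ-correct (⟦ subᵖ ⟧ (m ∷ n ∷ [])))
        (trans (cong pred (subᵖ-correct m n)) (pred[m∸n]≡m∸[1+n] n m))

eqᵖ-correct : ∀ m n → Holds eqᵖ (m ∷ n ∷ []) ⇔ m ≡ n
eqᵖ-correct m n = mk⇔ to from
  where
  value : ⟦ eqᵖ ⟧ (m ∷ n ∷ []) ≡ (n ∸ m) + (m ∸ n)
  value = trans (addᵖ-correct (⟦ subᵖ ⟧ (m ∷ n ∷ [])) (⟦ subᵖ ⟧ (n ∷ m ∷ [])))
                (cong₂ _+_ (subᵖ-correct m n) (subᵖ-correct n m))

  to : Holds eqᵖ (m ∷ n ∷ []) → m ≡ n
  to h = ≤-antisym (m∸n≡0⇒m≤n (m+n≡0⇒n≡0 (n ∸ m) (trans (sym value) h)))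
                   (m∸n≡0⇒m≤n (m+n≡0⇒m≡0 (n ∸ m) (trans (sym value) h)))

  from : m ≡ n → Holds eqᵖ (m ∷ n ∷ [])
  from refl = trans value (cong₂ _+_ (n∸n≡0 m) (n∸n≡0 m))

infix  25 _[_]ᵗ _[_]ᵗˢ _[_]
infix  20 ¬ᶠ_
infixr 18 _∧ᶠ_
infixr 17 _∨ᶠ_
infixr 16 _⇒_

-- 𝓛ε, with n the number of free variables (de Bruijn).  Since 𝓛_ω is the
-- union of the iterated Skolemizations of 𝓛₀, its terms, quantifier-free
-- formulas and Skolem functions are generated simultaneously.

mutual
  data Term (n : ℕ) : Set where
    var : Fin n → Term n
    𝟎   : Term n
    𝐒   : Term n → Term n
    app : ∀ {k} → Skolem k → Vec (Term n) k → Term n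

  data Formula (n : ℕ) : Set where
    rel  : ∀ {k} → PR k → Vec (Term n) k → Formula n
    ¬ᶠ_  : Formula n → Formula n
    _∧ᶠ_ : Formula n → Formula n → Formula n
    _∨ᶠ_ : Formula n → Formula n → Formula n

  -- skolem φ is the symbol c_{∃x.φ[x,y₁,…,yₖ]}; in φ, variable 0 is x and
  -- variable i is yᵢ.  The side condition is irrelevant, so that a symbol is
  -- determined by φ.
  data Skolem (k : ℕ) : Set where
    skolem : (φ : Formula (suc k)) →
             .(NoClosedSkolem {1} (φ [ var zero ∷ replicate k 𝟎 ])) →
             Skolem k

  -- Simultaneous substitution: ts lists the terms replacing variables 0, 1, ….
  _[_]ᵗ : ∀ {m n} → Term m → Vec (Term n) m → Term n
  var i    [ ts ]ᵗ = lookup ts i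
  𝟎        [ ts ]ᵗ = 𝟎
  𝐒 t      [ ts ]ᵗ = 𝐒 (t [ ts ]ᵗ)
  app c ss [ ts ]ᵗ = app c (ss [ ts ]ᵗˢ)

  _[_]ᵗˢ : ∀ {k m n} → Vec (Term m) k → Vec (Term n) m → Vec (Term n) k
  []       [ ts ]ᵗˢ = []
  (s ∷ ss) [ ts ]ᵗˢ = (s [ ts ]ᵗ) ∷ (ss [ ts ]ᵗˢ)

  _[_] : ∀ {m n} → Formula m → Vec (Term n) m → Formula n
  rel R ss [ ts ] = rel R (ss [ ts ]ᵗˢ)
  (¬ᶠ φ)   [ ts ] = ¬ᶠ (φ [ ts ])
  (φ ∧ᶠ ψ) [ ts ] = (φ [ ts ]) ∧ᶠ (ψ [ ts ])
  (φ ∨ᶠ ψ) [ ts ] = (φ [ ts ]) ∨ᶠ (ψ [ ts ])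

  ClosedTerm : ∀ {n} → Term n → Set
  ClosedTerm (var i)    = ⊥
  ClosedTerm 𝟎          = ⊤
  ClosedTerm (𝐒 t)      = ClosedTerm t
  ClosedTerm (app c ts) = ClosedTerms ts

  ClosedTerms : ∀ {n k} → Vec (Term n) k → Set
  ClosedTerms []       = ⊤
  ClosedTerms (t ∷ ts) = ClosedTerm t × ClosedTerms ts

  -- No subterm is a closed Skolem term (a closed term c(t₁,…,tₖ)).
  NoClosedSkolem : ∀ {n} → Formula n → Set
  NoClosedSkolem (rel R ts) = NoClosedSkolemᵗˢ ts
  NoClosedSkolem (¬ᶠ φ)     = NoClosedSkolem φ
  NoClosedSkolem (φ ∧ᶠ ψ)   = NoClosedSkolem φ × NoClosedSkolem ψ
  NoClosedSkolem (φ ∨ᶠ ψ)   = NoClosedSkolem φ × NoClosedSkolem ψ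

  NoClosedSkolemᵗ : ∀ {n} → Term n → Set
  NoClosedSkolemᵗ (var i)    = ⊤
  NoClosedSkolemᵗ 𝟎          = ⊤
  NoClosedSkolemᵗ (𝐒 t)      = NoClosedSkolemᵗ t
  NoClosedSkolemᵗ (app c ts) = ¬ ClosedTerms ts × NoClosedSkolemᵗˢ ts

  NoClosedSkolemᵗˢ : ∀ {n k} → Vec (Term n) k → Set
  NoClosedSkolemᵗˢ []       = ⊤
  NoClosedSkolemᵗˢ (t ∷ ts) = NoClosedSkolemᵗ t × NoClosedSkolemᵗˢ ts

body : ∀ {k} → Skolem k → Formula (suc k)
body (skolem φ _) = φ

_⇒_ : ∀ {n} → Formula n → Formula n → Formula n
φ ⇒ ψ = ¬ᶠ φ ∨ᶠ ψ

_≐_ : ∀ {n} → Term n → Term n → Formula n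
s ≐ t = rel eqᵖ (s ∷ t ∷ [])

infix 22 _≐_

vars : ∀ n → Vec (Term n) n
vars n = tabulate var

shift : ∀ n → Vec (Term (suc n)) n
shift n = tabulate (var ∘ suc)

-- For φ with distinguished variable x (variable 0): φ[t], and φ⟪t⟫ is φ with
-- x replaced by a term t that may itself contain x.
_⟨_⟩ : ∀ {n} → Formula (suc n) → Term n → Formula n
φ ⟨ t ⟩ = φ [ t ∷ vars _ ]

_⟪_⟫ : ∀ {n} → Formula (suc n) → Term (suc n) → Formula (suc n)
φ ⟪ t ⟫ = φ [ t ∷ shift _ ]

infix 25 _⟨_⟩ _⟪_⟫

weaken : ∀ {n} → Term n → Term (suc n)
weaken t = t [ shift _ ]ᵗ

-- Abbreviates∃ φ ψ: ψ is what ∃x.φ abbreviates.  The Skolem function is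
-- attached to a formula φ'[x,y⃗] of which φ is the instance φ'[x,t⃗], x not
-- occurring in t⃗.  A given φ can be written in this way for several φ' and t⃗;
-- all of them are admitted.
data Abbreviates∃ {n} (φ : Formula (suc n)) : Formula n → Set where
  abbr : ∀ {k} (c : Skolem k) (ts : Vec (Term n) k) →
         φ ≡ body c [ var zero ∷ Vec.map weaken ts ] →
         Abbreviates∃ φ (body c [ app c ts ∷ ts ])

data Critical {n} : Formula n → Set where
  ε-axiom : ∀ (φ : Formula (suc n)) t {ψ} →
            Abbreviates∃ φ ψ →
            Critical (φ ⟨ t ⟩ ⇒ ψ)
  induction : ∀ (φ : Formula (suc n)) t {ψ} →
              Abbreviates∃ (φ ∧ᶠ ¬ᶠ φ ⟪ 𝐒 (var zero) ⟫) ψ →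
              Critical (φ ⟨ 𝟎 ⟩ ∧ᶠ ¬ᶠ φ ⟨ t ⟩ ⇒ ψ)
  predecessor : ∀ (s : Term n) {ψ} →
                Abbreviates∃ (weaken s ≐ 𝐒 (var zero)) ψ →
                Critical (¬ᶠ (s ≐ 𝟎) ⇒ ψ)

ClosedCritical : Set
ClosedCritical = Σ (Formula 0) Critical

-- The canonical term c(n₁,…,nₖ), where nᵢ are the numerals of ns.
record Canonical : Set where
  constructor canonical
  field
    {arity} : ℕ
    symbol  : Skolem arity
    args    : Vec ℕ arity

data Value : Set where
  num : ℕ → Value
  ？  : Value

-- S e ≡ nothing means e ∉ dom(S).
EpsSub : Set
EpsSub = Canonical → Maybe Value

Finite : EpsSub → Set
Finite S = ∃[ es ] (∀ e → S e ≢ nothing → e ∈ es)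

standardExt : EpsSub → EpsSub
standardExt S e = just (fromMaybe ？ (S e))

numeral : ∀ {n} → ℕ → Term n
numeral zero    = 𝟎
numeral (suc m) = 𝐒 (numeral m)

numerals : ∀ {n k} → Vec ℕ k → Vec (Term n) k
numerals = Vec.map numeral

asNumeral : Term 0 → Maybe ℕ
asNumeral 𝟎         = just 0
asNumeral (𝐒 t)     = map suc (asNumeral t)
asNumeral (app c _) = nothing

asNumerals : ∀ {k} → Vec (Term 0) k → Maybe (Vec ℕ k)
asNumerals []       = just []
asNumerals (t ∷ ts) = zipWith _∷_ (asNumeral t) (asNumerals ts)

evalCanonical : EpsSub → Canonical → Term 0
evalCanonical S e@(canonical c ns) with S e
... | just ？      = 𝟎
... | just (num v) = numeral v
... | nothing      = app c (numerals ns)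

-- Canonical and non-canonical Skolem terms are treated uniformly: numerals
-- evaluate to themselves, so for a canonical term the first step is void.
mutual
  eval : EpsSub → Term 0 → Term 0
  eval S 𝟎          = 𝟎
  eval S (𝐒 t)      = 𝐒 (eval S t)
  eval S (app c ts) with asNumerals (evals S ts)
  ... | nothing = app c (evals S ts)
  ... | just ns = evalCanonical S (canonical c ns)

  evals : ∀ {k} → EpsSub → Vec (Term 0) k → Vec (Term 0) k
  evals S []       = []
  evals S (t ∷ ts) = eval S t ∷ evals S ts

infix 4 _⊨_

_⊨_ : EpsSub → Formula 0 → Set
S ⊨ rel R ts      = ∃[ ns ] evals S ts ≡ numerals ns × Holds R ns
S ⊨ φ ∧ᶠ ψ        = S ⊨ φ × S ⊨ ψ
S ⊨ φ ∨ᶠ ψ        = S ⊨ φ ⊎ S ⊨ ψ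
S ⊨ ¬ᶠ rel R ts   = ∃[ ns ] evals S ts ≡ numerals ns × ¬ Holds R ns
S ⊨ ¬ᶠ (φ ∧ᶠ ψ)   = S ⊨ ¬ᶠ φ ⊎ S ⊨ ¬ᶠ ψ
S ⊨ ¬ᶠ (φ ∨ᶠ ψ)   = S ⊨ ¬ᶠ φ × S ⊨ ¬ᶠ ψ
S ⊨ ¬ᶠ (¬ᶠ φ)     = S ⊨ φ

Correct : EpsSub → Set
Correct S =
  ∀ {k} (c : Skolem k) (ns : Vec ℕ k) v → S (canonical c ns) ≡ just (num v) →
  (standardExt S ⊨ body c [ numeral v ∷ numerals ns ]) ×
  (∀ u → u < v → standardExt S ⊨ ¬ᶠ (body c [ numeral u ∷ numerals ns ]))

Solving : EpsSub → List ClosedCritical → Set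
Solving S = All (λ Cr → standardExt S ⊨ proj₁ Cr)

-- The idea is Friedman's A-translation of the classical proof, with the
-- existence of the required ε-substitution as the answer type A.  Give each
-- canonical term its true value: the least witness of its body, or ？ if there
-- is none.  The body of c involves only Skolem functions of smaller rank, so
-- evidence for a value is defined by recursion on the rank: evidence for num v
-- is a finite set of evidenced values of smaller rank that forces v to be the
-- least witness, and evidence for ？ is a map from evidence for any num v to A.
-- Asking for a value means answering ？ first, and resuming from the same point
-- with num v as soon as evidence for num v turns up.  A run that meets no such
-- evidence ends with finitely many values that force all critical formulas;
-- together with all values in their evidence they form the ε-substitution, and
-- any conflict between them yields A.

module Submission where

open import Defs
open import Data.Bool using (Bool; true; false; not; _∧_; _∨_)
open import Data.Bool.Properties using (not-injective)
open import Data.Empty using (⊥-elim)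
open import Data.Fin as Fin using (zero; suc)
open import Data.List as List using (List; []; _∷_; _++_)
open import Data.List.Membership.Propositional using (_∈_; lose)
open import Data.List.Membership.Propositional.Properties using (∈-++⁺ˡ; ∈-++⁺ʳ; ∈-lookup)
open import Data.List.Relation.Unary.All as All using (All; []; _∷_)
import Data.List.Relation.Unary.All.Properties as All
open import Data.List.Relation.Unary.Any as Any using (any?)
import Data.List.Relation.Unary.Any.Properties as Any
open import Data.Maybe using (just; nothing; fromMaybe)
open import Data.Nat using (ℕ; zero; suc; _⊔_; _≤_; _<_; _≤′_; ≤′-refl; ≤′-step; s≤s)
import Data.Nat as ℕ
open import Data.Nat.Properties
  using (≤-refl; <-cmp; <⇒≢; <⇒≤; m≤n⇒m<n∨m≡n; m<n⇒m<1+n; n≤1+n; n<1+n; ≤⇒≤′;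
         m⊔n≤o⇒m≤o; m⊔n≤o⇒n≤o)
open import Data.Product using (Σ; Σ-syntax; _×_; _,_; proj₁; proj₂)
open import Data.Sum using (_⊎_; inj₁; inj₂)
open import Data.Unit using (⊤; tt)
open import Data.Vec as Vec using (Vec; []; _∷_; lookup)
open import Data.Vec.Properties using (≡-dec)
open import Function using (_∘_; Equivalence)
open import Relation.Binary using (DecidableEquality; tri<; tri≈; tri>)
open import Relation.Binary.PropositionalEquality
  using (_≡_; _≢_; refl; sym; trans; cong; cong₂; subst)
open import Relation.Nullary using (¬_; Dec; yes; no; contradiction)
open import Relation.Nullary.Decidable using (map′; _×-dec_)

-- Decidable equality of canonical terms

mutual
  _≟ᵖ_ : ∀ {n} → DecidableEquality (PR n)
  zeroᵖ     ≟ᵖ zeroᵖ       = yes refl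
  zeroᵖ     ≟ᵖ proj _      = no λ ()
  zeroᵖ     ≟ᵖ comp _ _    = no λ ()
  sucᵖ      ≟ᵖ sucᵖ        = yes refl
  sucᵖ      ≟ᵖ proj _      = no λ ()
  sucᵖ      ≟ᵖ comp _ _    = no λ ()
  sucᵖ      ≟ᵖ rec _ _     = no λ ()
  proj _    ≟ᵖ zeroᵖ       = no λ ()
  proj _    ≟ᵖ sucᵖ        = no λ ()
  proj i    ≟ᵖ proj j      = map′ (cong proj) (λ { refl → refl }) (i Fin.≟ j)
  proj _    ≟ᵖ comp _ _    = no λ ()
  proj _    ≟ᵖ rec _ _     = no λ ()
  comp _ _  ≟ᵖ zeroᵖ       = no λ ()
  comp _ _  ≟ᵖ sucᵖ        = no λ ()
  comp _ _  ≟ᵖ proj _      = no λ ()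
  comp {m} f gs ≟ᵖ comp {m′} f′ gs′ with m ℕ.≟ m′
  ... | no m≢m′ = no λ { refl → m≢m′ refl }
  ... | yes refl = map′ (λ { (refl , refl) → refl }) (λ { refl → refl , refl })
                        (f ≟ᵖ f′ ×-dec gs ≟ᵖˢ gs′)
  comp _ _  ≟ᵖ rec _ _     = no λ ()
  rec _ _   ≟ᵖ sucᵖ        = no λ ()
  rec _ _   ≟ᵖ proj _      = no λ ()
  rec _ _   ≟ᵖ comp _ _    = no λ ()
  rec f g   ≟ᵖ rec f′ g′   = map′ (λ { (refl , refl) → refl }) (λ { refl → refl , refl })
                                  (f ≟ᵖ f′ ×-dec g ≟ᵖ g′)

  _≟ᵖˢ_ : ∀ {n k} → DecidableEquality (Vec (PR n) k)
  []       ≟ᵖˢ []         = yes refl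
  (f ∷ fs) ≟ᵖˢ (g ∷ gs)   = map′ (λ { (refl , refl) → refl }) (λ { refl → refl , refl })
                                 (f ≟ᵖ g ×-dec fs ≟ᵖˢ gs)

mutual
  _≟ᵗ_ : ∀ {n} → DecidableEquality (Term n)
  var i    ≟ᵗ var j    = map′ (cong var) (λ { refl → refl }) (i Fin.≟ j)
  var _    ≟ᵗ 𝟎        = no λ ()
  var _    ≟ᵗ 𝐒 _      = no λ ()
  var _    ≟ᵗ app _ _  = no λ ()
  𝟎        ≟ᵗ var _    = no λ ()
  𝟎        ≟ᵗ 𝟎        = yes refl
  𝟎        ≟ᵗ 𝐒 _      = no λ ()
  𝟎        ≟ᵗ app _ _  = no λ ()
  𝐒 _      ≟ᵗ var _    = no λ ()
  𝐒 _      ≟ᵗ 𝟎        = no λ ()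
  𝐒 s      ≟ᵗ 𝐒 t      = map′ (cong 𝐒) (λ { refl → refl }) (s ≟ᵗ t)
  𝐒 _      ≟ᵗ app _ _  = no λ ()
  app _ _  ≟ᵗ var _    = no λ ()
  app _ _  ≟ᵗ 𝟎        = no λ ()
  app _ _  ≟ᵗ 𝐒 _      = no λ ()
  app {k} c ss ≟ᵗ app {k′} d ts with k ℕ.≟ k′
  ... | no k≢k′ = no λ { refl → k≢k′ refl }
  ... | yes refl = map′ (λ { (refl , refl) → refl }) (λ { refl → refl , refl })
                        (c ≟ˢ d ×-dec ss ≟ᵗˢ ts)

  _≟ᵗˢ_ : ∀ {n k} → DecidableEquality (Vec (Term n) k)
  []       ≟ᵗˢ []       = yes refl
  (s ∷ ss) ≟ᵗˢ (t ∷ ts) = map′ (λ { (refl , refl) → refl }) (λ { refl → refl , refl })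
                               (s ≟ᵗ t ×-dec ss ≟ᵗˢ ts)

  _≟ᶠ_ : ∀ {n} → DecidableEquality (Formula n)
  rel {k} P ss ≟ᶠ rel {k′} Q ts with k ℕ.≟ k′
  ... | no k≢k′ = no λ { refl → k≢k′ refl }
  ... | yes refl = map′ (λ { (refl , refl) → refl }) (λ { refl → refl , refl })
                        (P ≟ᵖ Q ×-dec ss ≟ᵗˢ ts)
  rel _ _  ≟ᶠ (¬ᶠ _)     = no λ ()
  rel _ _  ≟ᶠ (_ ∧ᶠ _)   = no λ ()
  rel _ _  ≟ᶠ (_ ∨ᶠ _)   = no λ ()
  (¬ᶠ _)   ≟ᶠ rel _ _    = no λ ()
  (¬ᶠ φ)   ≟ᶠ (¬ᶠ ψ)     = map′ (cong ¬ᶠ_) (λ { refl → refl }) (φ ≟ᶠ ψ)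
  (¬ᶠ _)   ≟ᶠ (_ ∧ᶠ _)   = no λ ()
  (¬ᶠ _)   ≟ᶠ (_ ∨ᶠ _)   = no λ ()
  (_ ∧ᶠ _) ≟ᶠ rel _ _    = no λ ()
  (_ ∧ᶠ _) ≟ᶠ (¬ᶠ _)     = no λ ()
  (φ ∧ᶠ ψ) ≟ᶠ (φ′ ∧ᶠ ψ′) = map′ (λ { (refl , refl) → refl }) (λ { refl → refl , refl })
                                (φ ≟ᶠ φ′ ×-dec ψ ≟ᶠ ψ′)
  (_ ∧ᶠ _) ≟ᶠ (_ ∨ᶠ _)   = no λ ()
  (_ ∨ᶠ _) ≟ᶠ rel _ _    = no λ ()
  (_ ∨ᶠ _) ≟ᶠ (¬ᶠ _)     = no λ ()
  (_ ∨ᶠ _) ≟ᶠ (_ ∧ᶠ _)   = no λ ()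
  (φ ∨ᶠ ψ) ≟ᶠ (φ′ ∨ᶠ ψ′) = map′ (λ { (refl , refl) → refl }) (λ { refl → refl , refl })
                                (φ ≟ᶠ φ′ ×-dec ψ ≟ᶠ ψ′)

  _≟ˢ_ : ∀ {k} → DecidableEquality (Skolem k)
  -- The side condition is irrelevant, so equal bodies already make equal symbols.
  skolem φ _ ≟ˢ skolem ψ _ = map′ (λ { refl → refl }) (λ { refl → refl }) (φ ≟ᶠ ψ)

_≟ᶜ_ : DecidableEquality Canonical
canonical {k} c ms ≟ᶜ canonical {k′} d ns with k ℕ.≟ k′
... | no k≢k′ = no λ { refl → k≢k′ refl }
... | yes refl = map′ (λ { (refl , refl) → refl }) (λ { refl → refl , refl })
                      (c ≟ˢ d ×-dec ≡-dec ℕ._≟_ ms ns)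

-- Evaluation in an environment, under a total valuation

-- Under a standard extension every closed term evaluates to a numeral, so Skolem functions may be
-- read as total functions.
Valuation : Set
Valuation = Canonical → ℕ

mutual
  ⟦_⟧ᵗ : ∀ {n} → Term n → Valuation → Vec ℕ n → ℕ
  ⟦ var i ⟧ᵗ    f ρ = lookup ρ i
  ⟦ 𝟎 ⟧ᵗ        f ρ = 0
  ⟦ 𝐒 t ⟧ᵗ      f ρ = suc (⟦ t ⟧ᵗ f ρ)
  ⟦ app c ts ⟧ᵗ f ρ = f (canonical c (⟦ ts ⟧ᵗˢ f ρ))

  ⟦_⟧ᵗˢ : ∀ {n k} → Vec (Term n) k → Valuation → Vec ℕ n → Vec ℕ k
  ⟦ [] ⟧ᵗˢ     f ρ = []
  ⟦ t ∷ ts ⟧ᵗˢ f ρ = ⟦ t ⟧ᵗ f ρ ∷ ⟦ ts ⟧ᵗˢ f ρ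

-- Boolean, because once the Skolem values are fixed a quantifier-free formula is decidable, and
-- `search` branches on the outcome.
truth : ∀ {n} → Formula n → Valuation → Vec ℕ n → Bool
truth (rel R ts) f ρ = ⟦ R ⟧ (⟦ ts ⟧ᵗˢ f ρ) ℕ.≡ᵇ 0
truth (¬ᶠ φ)     f ρ = not (truth φ f ρ)
truth (φ ∧ᶠ ψ)   f ρ = truth φ f ρ ∧ truth ψ f ρ
truth (φ ∨ᶠ ψ)   f ρ = truth φ f ρ ∨ truth ψ f ρ

lookup-⟦⟧ᵗˢ : ∀ {n k} (ts : Vec (Term n) k) i f ρ →
              lookup (⟦ ts ⟧ᵗˢ f ρ) i ≡ ⟦ lookup ts i ⟧ᵗ f ρ
lookup-⟦⟧ᵗˢ (t ∷ ts) zero    f ρ = refl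
lookup-⟦⟧ᵗˢ (t ∷ ts) (suc i) f ρ = lookup-⟦⟧ᵗˢ ts i f ρ

mutual
  ⟦[]⟧ᵗ : ∀ {m n} (t : Term m) (ts : Vec (Term n) m) f ρ →
          ⟦ t [ ts ]ᵗ ⟧ᵗ f ρ ≡ ⟦ t ⟧ᵗ f (⟦ ts ⟧ᵗˢ f ρ)
  ⟦[]⟧ᵗ (var i)    ts f ρ = sym (lookup-⟦⟧ᵗˢ ts i f ρ)
  ⟦[]⟧ᵗ 𝟎          ts f ρ = refl
  ⟦[]⟧ᵗ (𝐒 t)      ts f ρ = cong suc (⟦[]⟧ᵗ t ts f ρ)
  ⟦[]⟧ᵗ (app c ss) ts f ρ = cong (λ ns → f (canonical c ns)) (⟦[]⟧ᵗˢ ss ts f ρ)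

  ⟦[]⟧ᵗˢ : ∀ {k m n} (ss : Vec (Term m) k) (ts : Vec (Term n) m) f ρ →
           ⟦ ss [ ts ]ᵗˢ ⟧ᵗˢ f ρ ≡ ⟦ ss ⟧ᵗˢ f (⟦ ts ⟧ᵗˢ f ρ)
  ⟦[]⟧ᵗˢ []       ts f ρ = refl
  ⟦[]⟧ᵗˢ (s ∷ ss) ts f ρ = cong₂ _∷_ (⟦[]⟧ᵗ s ts f ρ) (⟦[]⟧ᵗˢ ss ts f ρ)

truth-[] : ∀ {m n} (φ : Formula m) (ts : Vec (Term n) m) f ρ →
           truth (φ [ ts ]) f ρ ≡ truth φ f (⟦ ts ⟧ᵗˢ f ρ)
truth-[] (rel R ss) ts f ρ = cong (λ ns → ⟦ R ⟧ ns ℕ.≡ᵇ 0) (⟦[]⟧ᵗˢ ss ts f ρ)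
truth-[] (¬ᶠ φ)     ts f ρ = cong not (truth-[] φ ts f ρ)
truth-[] (φ ∧ᶠ ψ)   ts f ρ = cong₂ _∧_ (truth-[] φ ts f ρ) (truth-[] ψ ts f ρ)
truth-[] (φ ∨ᶠ ψ)   ts f ρ = cong₂ _∨_ (truth-[] φ ts f ρ) (truth-[] ψ ts f ρ)

⟦numeral⟧ : ∀ {n} m f (ρ : Vec ℕ n) → ⟦ numeral m ⟧ᵗ f ρ ≡ m
⟦numeral⟧ zero    f ρ = refl
⟦numeral⟧ (suc m) f ρ = cong suc (⟦numeral⟧ m f ρ)

⟦numerals⟧ : ∀ {n k} (ms : Vec ℕ k) f (ρ : Vec ℕ n) → ⟦ numerals ms ⟧ᵗˢ f ρ ≡ ms
⟦numerals⟧ []       f ρ = refl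
⟦numerals⟧ (m ∷ ms) f ρ = cong₂ _∷_ (⟦numeral⟧ m f ρ) (⟦numerals⟧ ms f ρ)

⟦map-weaken⟧ : ∀ {k} (ts : Vec (Term 0) k) f u →
               ⟦ Vec.map weaken ts ⟧ᵗˢ f (u ∷ []) ≡ ⟦ ts ⟧ᵗˢ f []
⟦map-weaken⟧ []       f u = refl
⟦map-weaken⟧ (t ∷ ts) f u = cong₂ _∷_ (⟦[]⟧ᵗ t [] f (u ∷ [])) (⟦map-weaken⟧ ts f u)

-- Agreement with the satisfaction relation

toℕ : Value → ℕ
toℕ (num v) = v
toℕ ？      = 0

-- Terms outside the domain and terms with value `？` both get 0, as the standard extension evaluates
-- them.
valuation : EpsSub → Valuation
valuation S e = toℕ (fromMaybe ？ (S e))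

asNumeral-numeral : ∀ m → asNumeral (numeral m) ≡ just m
asNumeral-numeral zero = refl
asNumeral-numeral (suc m) rewrite asNumeral-numeral m = refl

asNumerals-numerals : ∀ {k} (ms : Vec ℕ k) → asNumerals (numerals ms) ≡ just ms
asNumerals-numerals [] = refl
asNumerals-numerals (m ∷ ms)
  rewrite asNumeral-numeral m | asNumerals-numerals ms = refl

evalCanonical-standardExt : ∀ S e →
  evalCanonical (standardExt S) e ≡ numeral (valuation S e)
evalCanonical-standardExt S e with S e
... | just (num v) = refl
... | just ？      = refl
... | nothing      = refl

mutual
  eval-standardExt : ∀ S t → eval (standardExt S) t ≡ numeral (⟦ t ⟧ᵗ (valuation S) [])
  eval-standardExt S 𝟎     = refl
  eval-standardExt S (𝐒 t) = cong 𝐒 (eval-standardExt S t)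
  eval-standardExt S (app c ts)
    rewrite evals-standardExt S ts | asNumerals-numerals (⟦ ts ⟧ᵗˢ (valuation S) []) =
    evalCanonical-standardExt S (canonical c (⟦ ts ⟧ᵗˢ (valuation S) []))

  evals-standardExt : ∀ {k} S (ts : Vec (Term 0) k) →
    evals (standardExt S) ts ≡ numerals (⟦ ts ⟧ᵗˢ (valuation S) [])
  evals-standardExt S []       = refl
  evals-standardExt S (t ∷ ts) = cong₂ _∷_ (eval-standardExt S t) (evals-standardExt S ts)

mutual
  -- Satisfaction pushes negations inward, so truth and falsity are treated together, with `¬ᶠ_`
  -- swapping the two.
  truth⇒⊨ : ∀ S φ → truth φ (valuation S) [] ≡ true → standardExt S ⊨ φ
  truth⇒⊨ S (rel R ts) p =
    ⟦ ts ⟧ᵗˢ (valuation S) [] , evals-standardExt S ts , zero-of _ p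
    where
    zero-of : ∀ m → (m ℕ.≡ᵇ 0) ≡ true → m ≡ 0
    zero-of zero _ = refl
  truth⇒⊨ S (¬ᶠ φ) p = falsity⇒⊨¬ S φ (not-injective p)
  truth⇒⊨ S (φ ∧ᶠ ψ) p with truth φ (valuation S) [] in q | truth ψ (valuation S) [] in r
  ... | true | true = truth⇒⊨ S φ q , truth⇒⊨ S ψ r
  truth⇒⊨ S (φ ∨ᶠ ψ) p with truth φ (valuation S) [] in q
  ... | true  = inj₁ (truth⇒⊨ S φ q)
  ... | false = inj₂ (truth⇒⊨ S ψ p)

  falsity⇒⊨¬ : ∀ S φ → truth φ (valuation S) [] ≡ false → standardExt S ⊨ ¬ᶠ φ
  falsity⇒⊨¬ S (rel R ts) p =
    ⟦ ts ⟧ᵗˢ (valuation S) [] , evals-standardExt S ts , nonzero-of _ p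
    where
    nonzero-of : ∀ m → (m ℕ.≡ᵇ 0) ≡ false → ¬ (m ≡ 0)
    nonzero-of (suc m) _ ()
  falsity⇒⊨¬ S (¬ᶠ φ) p = truth⇒⊨ S φ (not-injective p)
  falsity⇒⊨¬ S (φ ∧ᶠ ψ) p with truth φ (valuation S) [] in q
  ... | false = inj₁ (falsity⇒⊨¬ S φ q)
  ... | true  = inj₂ (falsity⇒⊨¬ S ψ p)
  falsity⇒⊨¬ S (φ ∨ᶠ ψ) p with truth φ (valuation S) [] in q | truth ψ (valuation S) [] in r
  ... | false | false = falsity⇒⊨¬ S φ q , falsity⇒⊨¬ S ψ r

-- Least witnesses and critical formulas

Witness : Valuation → Canonical → ℕ → Set
Witness f (canonical c ns) v = truth (body c) f (v ∷ ns) ≡ true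

NonWitness : Valuation → Canonical → ℕ → Set
NonWitness f (canonical c ns) v = truth (body c) f (v ∷ ns) ≡ false

Least : Valuation → Canonical → ℕ → Set
Least f e v = Witness f e v × (∀ u → u < v → NonWitness f e u)

witness≢nonWitness : ∀ {f v} e → Witness f e v → ¬ NonWitness f e v
witness≢nonWitness e p q with trans (sym p) q
... | ()

least-unique : ∀ {f u v} e → Least f e u → Least f e v → u ≡ v
least-unique {u = u} {v} e (wu , minu) (wv , minv) with <-cmp u v
... | tri< u<v _ _ = ⊥-elim (witness≢nonWitness e wu (minv u u<v))
... | tri≈ _ u≡v _ = u≡v
... | tri> _ _ v<u = ⊥-elim (witness≢nonWitness e wv (minu v v<u))

truth-body-numerals : ∀ {k} (c : Skolem k) f u ns →
  truth (body c [ numeral u ∷ numerals ns ]) f [] ≡ truth (body c) f (u ∷ ns)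
truth-body-numerals c f u ns =
  trans (truth-[] (body c) (numeral u ∷ numerals ns) f [])
        (cong (truth (body c) f) (cong₂ _∷_ (⟦numeral⟧ u f []) (⟦numerals⟧ ns f [])))

extend-nonWitness : ∀ {f n} e → (∀ u → u < n → NonWitness f e u) → NonWitness f e n →
                    ∀ u → u < suc n → NonWitness f e u
extend-nonWitness e none p u (s≤s u≤n) with m≤n⇒m<n∨m≡n u≤n
... | inj₁ u<n  = none u u<n
... | inj₂ refl = p

-- Unlike the absence of any witness at all, the second alternative can be established by a finite
-- search.
SearchedUpTo : Valuation → Canonical → ℕ → Set
SearchedUpTo f e n = Witness f e (f e) ⊎ (∀ u → u ≤ n → NonWitness f e u)

-- A critical formula holds as soon as the value of one canonical term c(ts) is
-- a witness, or there is none up to the value of one term.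
record Pivot (χ : Formula 0) : Set where
  field
    {arity} : ℕ
    symbol  : Skolem arity
    args    : Vec (Term 0) arity
    bound   : Term 0
    suffices : ∀ f → SearchedUpTo f (canonical symbol (⟦ args ⟧ᵗˢ f [])) (⟦ bound ⟧ᵗ f []) →
               truth χ f [] ≡ true

⇒-true : ∀ a {b} → b ≡ true ⊎ a ≡ false → not a ∨ b ≡ true
⇒-true true  (inj₁ p) = p
⇒-true false _        = refl

truth-instance : ∀ {k} {φ : Formula 1} (c : Skolem k) ts →
  φ ≡ body c [ var zero ∷ Vec.map weaken ts ] →
  ∀ f u → truth φ f (u ∷ []) ≡ truth (body c) f (u ∷ ⟦ ts ⟧ᵗˢ f [])
truth-instance c ts refl f u =
  trans (truth-[] (body c) (var zero ∷ Vec.map weaken ts) f (u ∷ []))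
        (cong (λ ms → truth (body c) f (u ∷ ms)) (⟦map-weaken⟧ ts f u))

-- A witness makes the consequent true, since that is the body of `c` at its own Skolem term.
-- Otherwise `refutes` makes the antecedent false.
implication-pivot : ∀ {φ : Formula 1} {ψ} (χ : Formula 0) (t : Term 0) →
  Abbreviates∃ φ ψ →
  (∀ f → (∀ u → u ≤ ⟦ t ⟧ᵗ f [] → truth φ f (u ∷ []) ≡ false) → truth χ f [] ≡ false) →
  Pivot (χ ⇒ ψ)
implication-pivot χ t (abbr c ts eq) refutes = record
  { symbol = c ; args = ts ; bound = t
  ; suffices = λ f → λ where
      (inj₁ w) → ⇒-true _ (inj₁ (trans (truth-[] (body c) (app c ts ∷ ts) f []) w))
      (inj₂ none) → ⇒-true (truth χ f []) (inj₂ (refutes f λ u u≤n →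
        trans (truth-instance c ts eq f u) (none u u≤n)))
  }

induction-step : ∀ {a b} → a ∧ not b ≡ false → a ≡ true → b ≡ true
induction-step {true} {true} _ _ = refl

critical-pivot : ∀ {χ} → Critical χ → Pivot χ
critical-pivot (ε-axiom φ t ab) = implication-pivot (φ ⟨ t ⟩) t ab λ f none →
  trans (truth-[] φ (t ∷ []) f []) (none _ ≤-refl)
critical-pivot (induction φ t ab) = implication-pivot (φ ⟨ 𝟎 ⟩ ∧ᶠ ¬ᶠ φ ⟨ t ⟩) t ab refutes
  where
  refutes : ∀ f → (∀ u → u ≤ ⟦ t ⟧ᵗ f [] → truth (φ ∧ᶠ ¬ᶠ φ ⟪ 𝐒 (var zero) ⟫) f (u ∷ []) ≡ false) →
            truth (φ ⟨ 𝟎 ⟩ ∧ᶠ ¬ᶠ φ ⟨ t ⟩) f [] ≡ false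
  refutes f none rewrite truth-[] φ (𝟎 ∷ []) f [] | truth-[] φ (t ∷ []) f []
    with truth φ f (0 ∷ []) in base
  ... | false = refl
  ... | true  = cong not (all-true _ ≤-refl)
    where
    -- No `u` up to the value of `t` is a jump from true to false, so truth at 0 propagates up to
    -- `t`.
    all-true : ∀ u → u ≤ ⟦ t ⟧ᵗ f [] → truth φ f (u ∷ []) ≡ true
    all-true zero    _   = base
    all-true (suc u) u<n =
      trans (sym (truth-[] φ (𝐒 (var zero) ∷ []) f (u ∷ [])))
            (induction-step (none u (<⇒≤ u<n))
                            (all-true u (<⇒≤ u<n)))
critical-pivot (predecessor s ab) = implication-pivot (¬ᶠ (s ≐ 𝟎)) s ab refutes
  where
  holds : ∀ m n → m ≡ n → (⟦ eqᵖ ⟧ (m ∷ n ∷ []) ℕ.≡ᵇ 0) ≡ true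
  holds m n m≡n rewrite Equivalence.from (eqᵖ-correct m n) m≡n = refl

  refutes : ∀ f → (∀ u → u ≤ ⟦ s ⟧ᵗ f [] → truth (weaken s ≐ 𝐒 (var zero)) f (u ∷ []) ≡ false) →
            truth (¬ᶠ (s ≐ 𝟎)) f [] ≡ false
  refutes f none with ⟦ s ⟧ᵗ f [] in eq
  ... | zero  = refl
  -- The predecessor `m` lies within the bound and satisfies the equation, contrary to `none`.
  ... | suc m with trans (sym (none m (n≤1+n m)))
                         (holds _ _ (trans (⟦[]⟧ᵗ s [] f (m ∷ [])) eq))
  ...   | ()

-- The rank of a Skolem function exceeds the ranks of those in its body

mutual
  rankᵗ : ∀ {n} → Term n → ℕ
  rankᵗ (var i)    = 0
  rankᵗ 𝟎          = 0
  rankᵗ (𝐒 t)      = rankᵗ t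
  -- Owing to `suc`, a formula of rank at most `r` contains only symbols of rank below `r`, the ones
  -- that `Knowledge r` covers.
  rankᵗ (app c ts) = suc (rankˢ c) ⊔ rankᵗˢ ts

  rankᵗˢ : ∀ {n k} → Vec (Term n) k → ℕ
  rankᵗˢ []       = 0
  rankᵗˢ (t ∷ ts) = rankᵗ t ⊔ rankᵗˢ ts

  rankᶠ : ∀ {n} → Formula n → ℕ
  rankᶠ (rel R ts) = rankᵗˢ ts
  rankᶠ (¬ᶠ φ)     = rankᶠ φ
  rankᶠ (φ ∧ᶠ ψ)   = rankᶠ φ ⊔ rankᶠ ψ
  rankᶠ (φ ∨ᶠ ψ)   = rankᶠ φ ⊔ rankᶠ ψ

  rankˢ : ∀ {k} → Skolem k → ℕ
  rankˢ (skolem φ _) = rankᶠ φ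

rank-body : ∀ {k} (c : Skolem k) → rankᶠ (body c) ≤ rankˢ c
rank-body (skolem φ _) = ≤-refl

rank : Canonical → ℕ
rank e = rankˢ (Canonical.symbol e)

module Backtracking (A : Set) where

  -- Evidenced values

  record Entry (r : ℕ) (Evidence : Canonical → Value → Set) : Set where
    constructor entry
    field
      term     : Canonical
      rank≡    : rank term ≡ r
      value    : Value
      evidence : Evidence term value

    Obeys : Valuation → Set
    Obeys f = f term ≡ toℕ value

  open Entry

  mutual
    -- The layer added at `suc r` concerns terms of rank exactly `r`, with evidence drawn from lower
    -- layers. Recursion on the rank thus admits the negative occurrence of `Forces` in the evidence
    -- for `？`.
    Knowledge : ℕ → Set
    Knowledge zero    = ⊤
    Knowledge (suc r) = Knowledge r × List (Entry r (Evidence r))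

    _⊩_ : ∀ {r} → Valuation → Knowledge r → Set
    _⊩_ {zero}  f _       = ⊤
    _⊩_ {suc r} f (K , L) = f ⊩ K × All (λ i → Obeys i f) L

    -- Quantifying over all valuations that obey `K` avoids any appeal to the true values, which are
    -- not computable.
    Forces : ℕ → (Valuation → Set) → Set
    Forces r P = Σ[ K ∈ Knowledge r ] (∀ f → f ⊩ K → P f)

    Evidence : ℕ → Canonical → Value → Set
    Evidence r e (num v) = Forces r (λ f → Least f e v)
    Evidence r e ？      = ∀ v → Forces r (λ f → Least f e v) → A

  ∅ : ∀ {r} → Knowledge r
  ∅ {zero}  = tt
  ∅ {suc r} = ∅ , []

  _∪_ : ∀ {r} → Knowledge r → Knowledge r → Knowledge r
  _∪_ {zero}  _       _         = tt
  _∪_ {suc r} (K , L) (K′ , L′) = K ∪ K′ , L ++ L′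

  ⊩-∪ : ∀ {r} f (K K′ : Knowledge r) → f ⊩ (K ∪ K′) → f ⊩ K × f ⊩ K′
  ⊩-∪ {zero}  f _       _         _       = tt , tt
  ⊩-∪ {suc r} f (K , L) (K′ , L′) (p , q) with ⊩-∪ f K K′ p | All.++⁻ L q
  ... | p₁ , p₂ | q₁ , q₂ = (p₁ , q₁) , (p₂ , q₂)

  lift : ∀ {r R} → r ≤′ R → Knowledge r → Knowledge R
  lift ≤′-refl       K = K
  lift (≤′-step r≤R) K = lift r≤R K , []

  ⊩-lift : ∀ {r R} (r≤R : r ≤′ R) f (K : Knowledge r) → f ⊩ lift r≤R K → f ⊩ K
  ⊩-lift ≤′-refl       f K p       = p
  ⊩-lift (≤′-step r≤R) f K (p , _) = ⊩-lift r≤R f K p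

  module _ {r : ℕ} where

    forces-pure : {P : Valuation → Set} → (∀ f → P f) → Forces r P
    forces-pure p = ∅ , λ f _ → p f

    forces-map : {P Q : Valuation → Set} → (∀ f → P f → Q f) → Forces r P → Forces r Q
    forces-map h (K , p) = K , λ f f⊩K → h f (p f f⊩K)

    forces-map₂ : {P Q R : Valuation → Set} → (∀ f → P f → Q f → R f) →
                  Forces r P → Forces r Q → Forces r R
    forces-map₂ h (K , p) (K′ , q) = K ∪ K′ , λ f f⊩ →
      h f (p f (proj₁ (⊩-∪ f K K′ f⊩))) (q f (proj₂ (⊩-∪ f K K′ f⊩)))

  forces-lift : ∀ {r R} {P : Valuation → Set} → r ≤ R → Forces r P → Forces R P
  forces-lift r≤R (K , p) =
    lift (≤⇒≤′ r≤R) K , λ f f⊩ → p f (⊩-lift (≤⇒≤′ r≤R) f K f⊩)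

  forces-value : ∀ {R} e val → rank e < R → Evidence (rank e) e val →
                 Forces R (λ f → f e ≡ toℕ val)
  forces-value e val e<R ev =
    forces-lift e<R ((∅ , entry e refl val ev ∷ []) , λ { f (_ , p ∷ []) → p })

  -- Evaluation in the continuation monad

  T : Set → Set
  T X = (X → A) → A

  return : {X : Set} → X → T X
  return x k = k x

  _>>=_ : {X Y : Set} → T X → (X → T Y) → T Y
  (m >>= h) k = m λ x → h x k

  -- The A-translated excluded middle for "`e` has a least witness": the inner use of `k` is the
  -- evidence for `？`.
  query : ∀ e → T (Σ Value (Evidence (rank e) e))
  query e k = k (？ , λ v ev → k (num v , ev))

  -- The computed value rests on provisional answers to queries, so the knowledge of these answers
  -- accompanies it.
  Determined : {X : Set} → ℕ → (Valuation → X) → Set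
  Determined {X} r g = T (Σ[ x ∈ X ] Forces r (λ f → g f ≡ x))

  module _ {r : ℕ} where

    determined-pure : {X : Set} (x : X) → Determined r (λ _ → x)
    determined-pure x = return (x , forces-pure λ _ → refl)

    determined-map : {X Y : Set} {g : Valuation → X} (op : X → Y) →
                     Determined r g → Determined r (op ∘ g)
    determined-map op m = m >>= λ (x , p) →
      return (op x , forces-map (λ _ → cong op) p)

    determined-map₂ : {X Y Z : Set} {g : Valuation → X} {h : Valuation → Y} (op : X → Y → Z) →
                      Determined r g → Determined r h → Determined r (λ f → op (g f) (h f))
    determined-map₂ op m m′ = m >>= λ (x , p) → m′ >>= λ (y , q) →
      return (op x y , forces-map₂ (λ _ → cong₂ op) p q)

    mutual
      determined-term : ∀ {n} (t : Term n) ρ → rankᵗ t ≤ r → Determined r (λ f → ⟦ t ⟧ᵗ f ρ)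
      determined-term (var i)    ρ t≤r = determined-pure (lookup ρ i)
      determined-term 𝟎          ρ t≤r = determined-pure 0
      determined-term (𝐒 t)      ρ t≤r = determined-map suc (determined-term t ρ t≤r)
      determined-term (app c ts) ρ t≤r =
        determined-terms ts ρ (m⊔n≤o⇒n≤o (suc (rankˢ c)) _ t≤r) >>= λ (ns , p) →
        query (canonical c ns) >>= λ (val , ev) →
        return (toℕ val ,
                forces-map₂ (λ f ts≡ e≡ → trans (cong (λ ms → f (canonical c ms)) ts≡) e≡) p
                  (forces-value (canonical c ns) val (m⊔n≤o⇒m≤o _ (rankᵗˢ ts) t≤r) ev))

      determined-terms : ∀ {n k} (ts : Vec (Term n) k) ρ → rankᵗˢ ts ≤ r →
                         Determined r (λ f → ⟦ ts ⟧ᵗˢ f ρ)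
      determined-terms []       ρ ts≤r = determined-pure []
      determined-terms (t ∷ ts) ρ ts≤r =
        determined-map₂ _∷_ (determined-term t ρ (m⊔n≤o⇒m≤o _ (rankᵗˢ ts) ts≤r))
                            (determined-terms ts ρ (m⊔n≤o⇒n≤o (rankᵗ t) _ ts≤r))

    determined-truth : ∀ {n} (φ : Formula n) ρ → rankᶠ φ ≤ r → Determined r (λ f → truth φ f ρ)
    determined-truth (rel R ts) ρ φ≤r =
      determined-map (λ ns → ⟦ R ⟧ ns ℕ.≡ᵇ 0) (determined-terms ts ρ φ≤r)
    determined-truth (¬ᶠ φ) ρ φ≤r = determined-map not (determined-truth φ ρ φ≤r)
    determined-truth (φ ∧ᶠ ψ) ρ φ≤r =
      determined-map₂ _∧_ (determined-truth φ ρ (m⊔n≤o⇒m≤o _ (rankᶠ ψ) φ≤r))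
                          (determined-truth ψ ρ (m⊔n≤o⇒n≤o (rankᶠ φ) _ φ≤r))
    determined-truth (φ ∨ᶠ ψ) ρ φ≤r =
      determined-map₂ _∨_ (determined-truth φ ρ (m⊔n≤o⇒m≤o _ (rankᶠ ψ) φ≤r))
                          (determined-truth ψ ρ (m⊔n≤o⇒n≤o (rankᶠ φ) _ φ≤r))

  -- By `rank-body` the truth of the body at each candidate rests on values of rank below that of
  -- `e`, so the first success counts as evidence for `e`.
  search : ∀ e n → T ((Σ[ v ∈ ℕ ] Forces (rank e) (λ f → Least f e v)) ⊎
                      Forces (rank e) (λ f → ∀ u → u < n → NonWitness f e u))
  search e zero = return (inj₂ (forces-pure λ _ _ ()))
  search e@(canonical c ns) (suc n) = search e n >>= λ where
    (inj₁ found) → return (inj₁ found)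
    (inj₂ none)  → determined-truth (body c) (n ∷ ns) (rank-body c) >>= λ where
      (true  , p) → return (inj₁ (n , forces-map₂ (λ _ → _,_) p none))
      (false , p) → return (inj₂ (forces-map₂ (λ f → extend-nonWitness {f} e) none p))

  search-pivot : ∀ {R} e n → rank e < R → T (Forces R (λ f → SearchedUpTo f e n))
  search-pivot e n e<R = query e >>= λ where
    (num v , ev) → return (forces-map₂ (λ f e≡v (w , _) → inj₁ (subst (Witness f e) (sym e≡v) w))
                             (forces-value e (num v) e<R ev)
                             (forces-lift (<⇒≤ e<R) ev))
    -- The bound of `search` is strict, while `n` itself must be covered.
    (？ , refute) → search e (suc n) >>= λ where
      -- A witness contradicts the provisional `？`: the current continuation is dropped, and
      -- `refute` resumes the run at the query with `v`.
      (inj₁ (v , ev)) → λ _ → refute v ev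
      (inj₂ none) → return (forces-map (λ f p → inj₂ λ u u≤n → p u (s≤s u≤n))
                              (forces-lift (<⇒≤ e<R) none))

  -- Solving the critical formulas through their pivots

  rankᵖ : ∀ {χ} → Pivot χ → ℕ
  rankᵖ P = suc (rankˢ symbol) ⊔ (rankᵗˢ args ⊔ rankᵗ bound)
    where open Pivot P

  solve-pivot : ∀ {χ R} (P : Pivot χ) → rankᵖ P ≤ R → T (Forces R (λ f → truth χ f [] ≡ true))
  solve-pivot {R = R} P P≤R =
    determined-terms args [] (m⊔n≤o⇒m≤o _ (rankᵗ bound) rest≤R) >>= λ (ns , p) →
    determined-term bound [] (m⊔n≤o⇒n≤o (rankᵗˢ args) _ rest≤R) >>= λ (n , q) →
    search-pivot (canonical symbol ns) n (m⊔n≤o⇒m≤o _ (rankᵗˢ args ⊔ rankᵗ bound) P≤R) >>= λ s →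
    return (forces-map₂ (λ { f (refl , refl) → suffices f }) (forces-map₂ (λ _ → _,_) p q) s)
    where
    open Pivot P
    rest≤R : rankᵗˢ args ⊔ rankᵗ bound ≤ R
    rest≤R = m⊔n≤o⇒n≤o (suc (rankˢ symbol)) _ P≤R

  rank* : List ClosedCritical → ℕ
  rank* []               = 0
  rank* ((χ , cr) ∷ Cr)  = rankᵖ (critical-pivot cr) ⊔ rank* Cr

  solve : ∀ {R} Cr → rank* Cr ≤ R →
          T (Forces R (λ f → All (λ χ → truth (proj₁ χ) f [] ≡ true) Cr))
  solve []              _    = return (forces-pure λ _ → [])
  solve ((χ , cr) ∷ Cr) Cr≤R =
    solve-pivot (critical-pivot cr) (m⊔n≤o⇒m≤o _ (rank* Cr) Cr≤R) >>= λ p →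
    solve Cr (m⊔n≤o⇒n≤o (rankᵖ (critical-pivot cr)) _ Cr≤R) >>= λ ps →
    return (forces-map₂ (λ _ → _∷_) p ps)

  -- From knowledge to a finite correct substitution

  _≈[_]_ : Valuation → ℕ → Valuation → Set
  f ≈[ r ] g = ∀ e → rank e < r → f e ≡ g e

  -- Correctness and forcing are asked of every valuation agreeing with `S` below `r`, so that they
  -- survive the later addition of values of higher rank.
  record Model {r : ℕ} (K : Knowledge r) : Set where
    field
      S       : EpsSub
      finite  : Finite S
      correct : ∀ e v → S e ≡ just (num v) → ∀ g → g ≈[ r ] valuation S → Least g e v
      forced  : ∀ g → g ≈[ r ] valuation S → g ⊩ K

  -- What the numerals in `L` rest on; obeying it makes them least witnesses. Evidence for `？` is a
  -- function and brings no knowledge with it.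
  underlying : ∀ {r} → List (Entry r (Evidence r)) → Knowledge r
  underlying []                               = ∅
  underlying (entry _ _ (num _) (K , _) ∷ L) = K ∪ underlying L
  underlying (entry _ _ ？ _ ∷ L)            = underlying L

  Sound : ∀ {r} → Valuation → Entry r (Evidence r) → Set
  Sound f i = ∀ v → value i ≡ num v → Least f (term i) v

  underlying-sound : ∀ {r} f (L : List (Entry r (Evidence r))) → f ⊩ underlying L →
                     ∀ {i} → i ∈ L → Sound f i
  underlying-sound f (entry _ _ (num _) (K , p) ∷ L) f⊩ (Any.here refl) _ refl =
    p f (proj₁ (⊩-∪ f K (underlying L) f⊩))
  underlying-sound f (entry _ _ (num _) (K , p) ∷ L) f⊩ (Any.there i∈L) =
    underlying-sound f L (proj₂ (⊩-∪ f K (underlying L) f⊩)) i∈L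
  underlying-sound f (entry _ _ ？ _ ∷ L) f⊩ (Any.here refl) _ ()
  underlying-sound f (entry _ _ ？ _ ∷ L) f⊩ (Any.there i∈L) = underlying-sound f L f⊩ i∈L

  -- Two numerals are least witnesses under the same `f`, hence equal. A numeral against `？` yields
  -- `A` by applying the evidence for `？` to that for the numeral.
  agree-or-answer : ∀ {r} f (i j : Entry r (Evidence r)) → term i ≡ term j →
                    Sound f i → Sound f j → A ⊎ toℕ (value i) ≡ toℕ (value j)
  agree-or-answer f (entry e _ (num u) p) (entry _ _ (num v) q) refl si sj =
    inj₂ (least-unique e (si u refl) (sj v refl))
  agree-or-answer f (entry _ _ (num u) p) (entry _ _ ？ q) refl _ _ = inj₁ (q u p)
  agree-or-answer f (entry _ _ ？ p) (entry _ _ (num v) q) refl _ _ = inj₁ (p v q)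
  agree-or-answer f (entry _ _ ？ p) (entry _ _ ？ q)      refl _ _ = inj₂ refl

  all-or-answer : {X : Set} {P : X → Set} (xs : List X) →
                  (∀ {x} → x ∈ xs → A ⊎ P x) → A ⊎ All P xs
  all-or-answer []       h = inj₂ []
  all-or-answer (x ∷ xs) h with h (Any.here refl) | all-or-answer xs (h ∘ Any.there)
  ... | inj₁ a | _       = inj₁ a
  ... | inj₂ _ | inj₁ a  = inj₁ a
  ... | inj₂ p | inj₂ ps = inj₂ (p ∷ ps)

  module Extension {r} (K : Knowledge r) (L : List (Entry r (Evidence r)))
                   (M : Model (K ∪ underlying L)) where
    open Model M renaming (S to S₀; finite to finite₀; correct to correct₀; forced to forced₀)

    ∈L? : ∀ e → Dec (Any.Any (λ i → e ≡ term i) L)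
    ∈L? e = any? (λ i → e ≟ᶜ term i) L

    S : EpsSub
    S e with rank e ℕ.≟ r | ∈L? e
    ... | no _  | _      = S₀ e
    -- Several entries may concern `e`. One is chosen here, and `obeys-or-answer` compares the
    -- others with it.
    ... | yes _ | yes i∈ = just (value (Any.lookup i∈))
    ... | yes _ | no _   = nothing

    finite : Finite S
    finite = proj₁ finite₀ ++ List.map term L , covers
      where
      covers : ∀ e → S e ≢ nothing → e ∈ proj₁ finite₀ ++ List.map term L
      covers e p with rank e ℕ.≟ r | ∈L? e
      ... | no _  | _      = ∈-++⁺ˡ (proj₂ finite₀ e p)
      ... | yes _ | yes i∈ = ∈-++⁺ʳ (proj₁ finite₀) (Any.map⁺ i∈)
      ... | yes _ | no _   = ⊥-elim (p refl)

    extends : ∀ {g} → g ≈[ suc r ] valuation S → g ≈[ r ] valuation S₀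
    extends {g} g≈ e e<r = trans (g≈ e (m<n⇒m<1+n e<r)) (cong (toℕ ∘ fromMaybe ？) same)
      where
      same : S e ≡ S₀ e
      same with rank e ℕ.≟ r
      ... | no _    = refl
      ... | yes e≡r = contradiction e≡r (<⇒≢ e<r)

    sound : ∀ {g} → g ≈[ r ] valuation S₀ → ∀ {i} → i ∈ L → Sound g i
    sound {g} g≈ = underlying-sound g L (proj₂ (⊩-∪ g K (underlying L) (forced₀ g g≈)))

    correct : ∀ e v → S e ≡ just (num v) → ∀ g → g ≈[ suc r ] valuation S → Least g e v
    correct e v p g g≈ with rank e ℕ.≟ r | ∈L? e
    ... | no _  | _      = correct₀ e v p g (extends g≈)
    ... | yes _ | yes i∈ =
      subst (λ e → Least g e v) (sym (Any.lookup-result i∈))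
            (sound (extends g≈) (∈-lookup (Any.index i∈)) v (just-inj p))
      where
      just-inj : ∀ {x y : Value} → just x ≡ just y → x ≡ y
      just-inj refl = refl

    obeys-or-answer : ∀ {i} → i ∈ L → A ⊎ Obeys i (valuation S)
    obeys-or-answer {i} i∈L with rank (term i) ℕ.≟ r | ∈L? (term i)
    ... | no ≢r | _      = contradiction (rank≡ i) ≢r
    ... | yes _ | no ∉L  = contradiction (lose i∈L refl) ∉L
    ... | yes _ | yes j∈ = agree-or-answer (valuation S₀) (Any.lookup j∈) i
      (sym (Any.lookup-result j∈)) (sound (λ _ _ → refl) (∈-lookup (Any.index j∈)))
      (sound (λ _ _ → refl) i∈L)

    model : A ⊎ Model {suc r} (K , L)
    model with all-or-answer L obeys-or-answer
    ... | inj₁ a     = inj₁ a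
    ... | inj₂ obeys = inj₂ record
      { S = S ; finite = finite ; correct = correct
      ; forced = λ g g≈ →
          proj₁ (⊩-∪ g K (underlying L) (forced₀ g (extends g≈))) ,
          All.map (λ {i} p → trans (g≈ (term i) (subst (_< suc r) (sym (rank≡ i)) (n<1+n r))) p) obeys
      }

  -- Recursion on the rank: the knowledge underlying the top layer is first merged into the lower
  -- layers, so a model of these already justifies the numerals of the top layer.
  complete : ∀ r (K : Knowledge r) → A ⊎ Model K
  complete zero _ = inj₂ record
    { S = λ _ → nothing ; finite = [] , (λ _ p → ⊥-elim (p refl))
    ; correct = λ _ _ () ; forced = λ _ _ → tt }
  complete (suc r) (K , L) with complete r (K ∪ underlying L)
  ... | inj₁ a = inj₁ a
  ... | inj₂ M = Extension.model K L M

-- Extracting the substitution from a completed run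

mainTheorem1 : Σ[ H ∈ (List ClosedCritical → EpsSub) ]
    (∀ (Cr : List ClosedCritical) →
    Finite (H Cr) × Correct (H Cr) × Solving (H Cr) Cr)
mainTheorem1 = (λ Cr → proj₁ (solution Cr)) , (λ Cr → proj₂ (solution Cr))
  where
  module _ (Cr : List ClosedCritical) where

    Solution : Set
    Solution = Σ[ S ∈ EpsSub ] (Finite S × Correct S × Solving S Cr)

    -- The answer type is the solution itself, so an `A` obtained from a conflict is already a
    -- complete result.
    open Backtracking Solution

    read-off : Forces (rank* Cr) (λ f → All (λ χ → truth (proj₁ χ) f [] ≡ true) Cr) → Solution
    read-off (K , solved) with complete (rank* Cr) K
    ... | inj₁ answer = answer
    ... | inj₂ M = S , finite , S-correct , S-solving
      where
      open Model M

      S-correct : Correct S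
      S-correct c ns v p with correct (canonical c ns) v p (valuation S) (λ _ _ → refl)
      ... | w , min =
        truth⇒⊨ S (body c [ numeral v ∷ numerals ns ])
          (trans (truth-body-numerals c (valuation S) v ns) w) ,
        λ u u<v → falsity⇒⊨¬ S (body c [ numeral u ∷ numerals ns ])
          (trans (truth-body-numerals c (valuation S) u ns) (min u u<v))

      S-solving : Solving S Cr
      S-solving = All.map (λ {χ} → truth⇒⊨ S (proj₁ χ))
                          (solved (valuation S) (forced (valuation S) λ _ _ → refl))

    solution : Solution
    -- `read-off` is the final continuation; after each resumption the run heads for it again.
    solution = solve Cr ≤-refl read-off
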